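{- Let $R=(g,f)$ be an ordinary Riordan array with general term $T_{n,k}=[x^n]\,g(x)f(x)^k$, $n,k\ge 0$. Let $A=(A_{n,k})_{n,k\ge 0}$ and $B=(B_{n,k})_{n,k\ge 0}$ be the matrices defined by $$A_{n,k}=T_{n+k,2k},\qquad B_{n,k}=T_{n+k+1,2k+1}.$$ Then $A$ and $B$ are ordinary Riordan arrays, namely $$A=\left(g,\frac{f^2}{x}\right),\qquad B=\left(g\,\frac{f}{x},\frac{f^2}{x}\right),$$ and moreover $$B=\left(\frac{f}{x},x\right)\cdot A .$$
   Context: An ordinary Riordan array $(g,f)$ is the infinite lower-triangular integer matrix $(T_{n,k})_{n,k\ge 0}$ with $T_{n,k}=[x^n]\,g(x)f(x)^k$, where $g,f$ are formal power series over the integers with $g(x)=1+g_1x+g_2x^2+\cdots$ and $f(x)=x+f_2x^2+f_3x^3+\cdots$, and $[x^n]$ denotes extraction of the coefficient of $x^n$. The product of Riordan arrays is $(g,f)\cdot(h,l)=(g\,(h\circ f),\,l\circ f)$. The matrix $A$ is obtained from $R$ by taking every second column starting with the first column (column index $0$) and raising the columns so as to obtain a lower-triangular matrix; $B$ is obtained in the same way starting with the second column (column index $1$). -}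

module Defs where

open import Data.Fin.Base using (toℕ)
open import Data.Integer.Base using (ℤ; 0ℤ; 1ℤ; _*_)
open import Data.Integer.Properties using (+-*-semiring)
open import Data.Nat.Base as ℕ using (ℕ; zero; suc; _∸_)
open import Data.Product.Base using (_×_; _,_)
open import Relation.Binary.PropositionalEquality.Core using (_≡_)

open import Algebra.Properties.Semiring.Sum +-*-semiring using (sum-syntax)

-- Formal power series over ℤ: `a n` is the coefficient [xⁿ] a.
FPS : Set
FPS = ℕ → ℤ

infixl 7 _⊛_
infixr 8 _^_
infixl 9 _/x
infixr 9 _∘_

1ₛ : FPS
1ₛ zero    = 1ℤ
1ₛ (suc _) = 0ℤ

X : FPS
X zero          = 0ℤ
X (suc zero)    = 1ℤ
X (suc (suc _)) = 0ℤ

-- `∑[ i < suc n ]` ranges over i : Fin (suc n), i.e. over 0 ≤ i ≤ n.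
_⊛_ : FPS → FPS → FPS
(a ⊛ b) n = ∑[ i < suc n ] (a (toℕ i) * b (n ∸ toℕ i))

_^_ : FPS → ℕ → FPS
a ^ zero  = 1ₛ
a ^ suc k = a ⊛ a ^ k

-- The quotient by x, for series with zero constant term.  (For other series
-- the constant term is discarded; it is only applied where `a 0` vanishes.)
_/x : FPS → FPS
(a /x) n = a (suc n)

-- The composite h(f(x)) = Σⱼ hⱼ f(x)ʲ, for f with zero constant term: then
-- [xⁿ] fʲ = 0 for j > n, so the sum for the n-th coefficient stops at j = n.
_∘_ : FPS → FPS → FPS
(h ∘ f) n = ∑[ j < suc n ] (h (toℕ j) * (f ^ toℕ j) n)

-- g = 1 + g₁x + g₂x² + ⋯  and  f = x + f₂x² + f₃x³ + ⋯
record IsRiordan (g f : FPS) : Set where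
  field
    g₀≡1 : g 0 ≡ 1ℤ
    f₀≡0 : f 0 ≡ 0ℤ
    f₁≡1 : f 1 ≡ 1ℤ

-- The pair (g , f); it is a Riordan array when `IsRiordan g f`.
RiordanPair : Set
RiordanPair = FPS × FPS

Matrix : Set
Matrix = ℕ → ℕ → ℤ

infix 4 _≈_
_≈_ : Matrix → Matrix → Set
M ≈ N = ∀ n k → M n k ≡ N n k

array : RiordanPair → Matrix
array (g , f) n k = (g ⊛ f ^ k) n

infixl 7 _·_
_·_ : RiordanPair → RiordanPair → RiordanPair
(g , f) · (h , l) = g ⊛ (h ∘ f) , l ∘ f

evenColumns : Matrix → Matrix
evenColumns T n k = T (n ℕ.+ k) (2 ℕ.* k)

oddColumns : Matrix → Matrix
oddColumns T n k = T (n ℕ.+ k ℕ.+ 1) (2 ℕ.* k ℕ.+ 1)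

{-# OPTIONS --safe #-}

-- Put F = f²/x.  For every series a with zero constant term,
-- [xⁿ⁺¹] a b = [xⁿ] (a/x) b.  Hence, moving one factor f² = x F at a time from
-- f²ᵏ into a, one gets [xⁿ⁺ᵏ] a f²ᵏ = [xⁿ] a Fᵏ for every series a.  The case
-- a = g gives A; the case a = g f, whose constant term vanishes, gives B.
module Submission where

open import Defs
open import Data.Product.Base using (_×_; _,_)
open import Algebra.Properties.Semiring.Sum using (sum-cong-≗)
open import Data.Fin.Base using (toℕ)
open import Data.Integer.Base using (0ℤ; 1ℤ; _+_; _*_)
open import Data.Integer.Properties
  using (+-*-semiring; +-identityˡ; +-identityʳ; *-zeroʳ; *-identityˡ; *-identityʳ; *-comm)
open import Data.Integer.Tactic.RingSolver using (solve-∀)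
open import Data.Nat.Base as ℕ using (zero; suc; _∸_)
import Data.Nat.Properties as ℕ
open import Relation.Binary.PropositionalEquality

⊛-cong : ∀ {a a′ b b′} → a ≗ a′ → b ≗ b′ → a ⊛ b ≗ a′ ⊛ b′
⊛-cong p q n = sum-cong-≗ +-*-semiring {suc n} λ i →
  cong₂ _*_ (p (toℕ i)) (q (n ∸ toℕ i))

^-cong : ∀ {a b} → a ≗ b → ∀ k → a ^ k ≗ b ^ k
^-cong p zero    n = refl
^-cong p (suc k) n = ⊛-cong p (^-cong p k) n

-- Shaped for associativity: the tail `(a ⊛ b) /x` computes to `a 0` times `b /x` plus `a /x ⊛ b`,
-- so one scaled and one unscaled summand suffice.
⊛-linearˡ : ∀ s a b c n →
  ((λ m → s * a m + b m) ⊛ c) n ≡ s * (a ⊛ c) n + (b ⊛ c) n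
⊛-linearˡ s a b c zero = eq s (a 0) (b 0) (c 0)
  where
  eq : ∀ s x y z → (s * x + y) * z + 0ℤ ≡ s * (x * z + 0ℤ) + (y * z + 0ℤ)
  eq = solve-∀
⊛-linearˡ s a b c (suc n) = trans
  (cong ((s * a 0 + b 0) * c (suc n) +_) (⊛-linearˡ s (a /x) (b /x) c n))
  (eq s (a 0) (b 0) (c (suc n)) ((a /x ⊛ c) n) ((b /x ⊛ c) n))
  where
  eq : ∀ s x y z u v →
    (s * x + y) * z + (s * u + v) ≡ s * (x * z + u) + (y * z + v)
  eq = solve-∀

⊛-assoc : ∀ a b c → (a ⊛ b) ⊛ c ≗ a ⊛ (b ⊛ c)
⊛-assoc a b c zero = eq (a 0) (b 0) (c 0)
  where
  eq : ∀ x y z → (x * y + 0ℤ) * z + 0ℤ ≡ x * (y * z + 0ℤ) + 0ℤ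
  eq = solve-∀
⊛-assoc a b c (suc n) = begin
  (a ⊛ b) 0 * c (suc n) + ((a ⊛ b) /x ⊛ c) n
    ≡⟨ cong ((a ⊛ b) 0 * c (suc n) +_) (⊛-linearˡ (a 0) (b /x) (a /x ⊛ b) c n) ⟩
  (a ⊛ b) 0 * c (suc n) + (a 0 * (b /x ⊛ c) n + ((a /x ⊛ b) ⊛ c) n)
    ≡⟨ cong (λ t → (a ⊛ b) 0 * c (suc n) + (a 0 * (b /x ⊛ c) n + t))
            (⊛-assoc (a /x) b c n) ⟩
  (a ⊛ b) 0 * c (suc n) + (a 0 * (b /x ⊛ c) n + (a /x ⊛ (b ⊛ c)) n)
    ≡⟨ eq (a 0) (b 0) (c (suc n)) ((b /x ⊛ c) n) ((a /x ⊛ (b ⊛ c)) n) ⟩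
  a 0 * (b ⊛ c) (suc n) + (a /x ⊛ (b ⊛ c)) n ∎
  where
  open ≡-Reasoning
  eq : ∀ x y z u v →
    (x * y + 0ℤ) * z + (x * u + v) ≡ x * (y * z + u) + v
  eq = solve-∀

-- The defining sum unfolds at its first term; this splits off the last one instead. Commutativity
-- follows by matching the two unfoldings.
⊛-sucʳ : ∀ a b n → (a ⊛ b) (suc n) ≡ a (suc n) * b 0 + (a ⊛ b /x) n
⊛-sucʳ a b zero = eq (a 0) (b 1) (a 1) (b 0)
  where
  eq : ∀ x y z w → x * y + (z * w + 0ℤ) ≡ z * w + (x * y + 0ℤ)
  eq = solve-∀
⊛-sucʳ a b (suc n) = trans
  (cong (a 0 * b (suc (suc n)) +_) (⊛-sucʳ (a /x) b n))
  (eq (a 0 * b (suc (suc n))) (a (suc (suc n)) * b 0) ((a /x ⊛ b /x) n))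
  where
  eq : ∀ x y z → x + (y + z) ≡ y + (x + z)
  eq = solve-∀

⊛-comm : ∀ a b → a ⊛ b ≗ b ⊛ a
⊛-comm a b zero    = cong (_+ 0ℤ) (*-comm (a 0) (b 0))
⊛-comm a b (suc n) = trans
  (cong₂ _+_ (*-comm (a 0) (b (suc n))) (⊛-comm (a /x) b n))
  (sym (⊛-sucʳ b a n))

⊛-zeroˡ : ∀ a → (λ _ → 0ℤ) ⊛ a ≗ λ _ → 0ℤ
⊛-zeroˡ a zero    = refl
⊛-zeroˡ a (suc n) = trans (+-identityˡ _) (⊛-zeroˡ a n)

⊛-identityˡ : ∀ a → 1ₛ ⊛ a ≗ a
⊛-identityˡ a zero    = trans (+-identityʳ _) (*-identityˡ (a 0))
⊛-identityˡ a (suc n) = trans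
  (cong₂ _+_ (*-identityˡ (a (suc n))) (⊛-zeroˡ a n))
  (+-identityʳ _)

⊛-identityʳ : ∀ a → a ⊛ 1ₛ ≗ a
⊛-identityʳ a n = trans (⊛-comm a 1ₛ n) (⊛-identityˡ a n)

/x-⊛ : ∀ a b → a 0 ≡ 0ℤ → (a ⊛ b) /x ≗ a /x ⊛ b
/x-⊛ a b a₀≡0 n = trans
  (cong (λ z → z * b (suc n) + (a /x ⊛ b) n) a₀≡0) (+-identityˡ _)

⊛-/x : ∀ a b → b 0 ≡ 0ℤ → (a ⊛ b) /x ≗ a ⊛ b /x
⊛-/x a b b₀≡0 n = begin
  (a ⊛ b) (suc n)   ≡⟨ ⊛-comm a b (suc n) ⟩
  (b ⊛ a) (suc n)   ≡⟨ /x-⊛ b a b₀≡0 n ⟩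
  (b /x ⊛ a) n      ≡⟨ ⊛-comm (b /x) a n ⟩
  (a ⊛ b /x) n      ∎
  where open ≡-Reasoning

⊛-const-zeroʳ : ∀ a b → b 0 ≡ 0ℤ → (a ⊛ b) 0 ≡ 0ℤ
⊛-const-zeroʳ a b b₀≡0 =
  trans (+-identityʳ _) (trans (cong (a 0 *_) b₀≡0) (*-zeroʳ (a 0)))

⊛-const-one : ∀ a b → a 0 ≡ 1ℤ → b 0 ≡ 1ℤ → (a ⊛ b) 0 ≡ 1ℤ
⊛-const-one a b a₀≡1 b₀≡1 = trans (+-identityʳ _) (cong₂ _*_ a₀≡1 b₀≡1)

X/x≗1 : X /x ≗ 1ₛ
X/x≗1 zero    = refl
X/x≗1 (suc _) = refl

-- In a positive degree the term `j = 0` vanishes, and in the others one factor `X` cancels against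
-- one degree, leaving the same claim for `h /x`.
∘-identityʳ : ∀ h → h ∘ X ≗ h
∘-identityʳ h zero    = trans (+-identityʳ _) (*-identityʳ (h 0))
∘-identityʳ h (suc n) = begin
  (h ∘ X) (suc n)
    ≡⟨ cong₂ _+_ (*-zeroʳ (h 0)) (sum-cong-≗ +-*-semiring {suc n} λ i →
         cong (h (suc (toℕ i)) *_) (X-shift (toℕ i))) ⟩
  0ℤ + ((h /x) ∘ X) n   ≡⟨ +-identityˡ _ ⟩
  ((h /x) ∘ X) n        ≡⟨ ∘-identityʳ (h /x) n ⟩
  h (suc n)           ∎
  where
  open ≡-Reasoning
  X-shift : ∀ j → (X ^ suc j) (suc n) ≡ (X ^ j) n
  X-shift j = trans (/x-⊛ X (X ^ j) refl n)
    (trans (⊛-cong {b = X ^ j} X/x≗1 (λ _ → refl) n) (⊛-identityˡ (X ^ j) n))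

^-two-⊛ : ∀ f b → f ^ 2 ⊛ b ≗ f ⊛ (f ⊛ b)
^-two-⊛ f b n = trans
  (⊛-cong {b = b} (⊛-cong {a = f} (λ _ → refl) (⊛-identityʳ f)) (λ _ → refl) n)
  (⊛-assoc f f b n)

^-two-const-zero : ∀ f → f 0 ≡ 0ℤ → (f ^ 2) 0 ≡ 0ℤ
^-two-const-zero f f₀≡0 = ⊛-const-zeroʳ f (f ^ 1)
  (trans (⊛-identityʳ f 0) f₀≡0)

⊛-^-even : ∀ f → f 0 ≡ 0ℤ → ∀ k a n →
  (a ⊛ f ^ (2 ℕ.* k)) (n ℕ.+ k) ≡ (a ⊛ ((f ^ 2) /x) ^ k) n
⊛-^-even f f₀≡0 zero    a n = cong (a ⊛ 1ₛ) (ℕ.+-identityʳ n)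
⊛-^-even f f₀≡0 (suc k) a n = begin
  (a ⊛ f ^ (2 ℕ.* suc k)) (n ℕ.+ suc k)
    -- With the successors in front, `^` releases two factors `f` by computation.
    ≡⟨ cong₂ (λ e m → (a ⊛ f ^ e) m) (ℕ.*-suc 2 k) (ℕ.+-suc n k) ⟩
  (a ⊛ (f ⊛ (f ⊛ f ^ (2 ℕ.* k)))) (suc n ℕ.+ k)
    ≡⟨ ⊛-cong {a = a} (λ _ → refl) (^-two-⊛ f (f ^ (2 ℕ.* k))) (suc n ℕ.+ k) ⟨
  (a ⊛ (f ^ 2 ⊛ f ^ (2 ℕ.* k))) (suc n ℕ.+ k)
    ≡⟨ ⊛-assoc a (f ^ 2) (f ^ (2 ℕ.* k)) (suc n ℕ.+ k) ⟨
  ((a ⊛ f ^ 2) ⊛ f ^ (2 ℕ.* k)) (suc n ℕ.+ k)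
    -- The series absorbs `f ^ 2` and the index keeps one extra unit, which the division by x in `F`
    -- then uses up.
    ≡⟨ ⊛-^-even f f₀≡0 k (a ⊛ f ^ 2) (suc n) ⟩
  ((a ⊛ f ^ 2) ⊛ F ^ k) (suc n)
    ≡⟨ /x-⊛ (a ⊛ f ^ 2) (F ^ k) (⊛-const-zeroʳ a (f ^ 2) f²₀≡0) n ⟩
  ((a ⊛ f ^ 2) /x ⊛ F ^ k) n
    ≡⟨ ⊛-cong {b = F ^ k} (⊛-/x a (f ^ 2) f²₀≡0) (λ _ → refl) n ⟩
  ((a ⊛ F) ⊛ F ^ k) n
    ≡⟨ ⊛-assoc a F (F ^ k) n ⟩
  (a ⊛ F ^ suc k) n ∎
  where
  open ≡-Reasoning
  F : FPS
  F = (f ^ 2) /x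
  f²₀≡0 : (f ^ 2) 0 ≡ 0ℤ
  f²₀≡0 = ^-two-const-zero f f₀≡0

⊛-^-odd : ∀ f → f 0 ≡ 0ℤ → ∀ k a n →
  (a ⊛ f ^ (2 ℕ.* k ℕ.+ 1)) (n ℕ.+ k ℕ.+ 1) ≡ ((a ⊛ f /x) ⊛ ((f ^ 2) /x) ^ k) n
⊛-^-odd f f₀≡0 k a n = begin
  (a ⊛ f ^ (2 ℕ.* k ℕ.+ 1)) (n ℕ.+ k ℕ.+ 1)
    ≡⟨ cong₂ (λ e m → (a ⊛ f ^ e) m) (ℕ.+-comm (2 ℕ.* k) 1) (ℕ.+-comm (n ℕ.+ k) 1) ⟩
  (a ⊛ (f ⊛ f ^ (2 ℕ.* k))) (suc n ℕ.+ k)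
    ≡⟨ ⊛-assoc a f (f ^ (2 ℕ.* k)) (suc n ℕ.+ k) ⟨
  ((a ⊛ f) ⊛ f ^ (2 ℕ.* k)) (suc n ℕ.+ k)
    -- The unpaired factor `f` joins the arbitrary series; the spare unit of the index later turns
    -- it into `f /x`.
    ≡⟨ ⊛-^-even f f₀≡0 k (a ⊛ f) (suc n) ⟩
  ((a ⊛ f) ⊛ F ^ k) (suc n)
    ≡⟨ /x-⊛ (a ⊛ f) (F ^ k) (⊛-const-zeroʳ a f f₀≡0) n ⟩
  ((a ⊛ f) /x ⊛ F ^ k) n
    ≡⟨ ⊛-cong {b = F ^ k} (⊛-/x a f f₀≡0) (λ _ → refl) n ⟩
  ((a ⊛ f /x) ⊛ F ^ k) n ∎
  where
  open ≡-Reasoning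
  F : FPS
  F = (f ^ 2) /x

mainTheorem1 :
    (g f : FPS) → IsRiordan g f →
    let A = evenColumns (array (g , f))
        B = oddColumns (array (g , f))
    in
    (IsRiordan g ((f ^ 2) /x) × A ≈ array (g , (f ^ 2) /x))
    × (IsRiordan (g ⊛ f /x) ((f ^ 2) /x) × B ≈ array (g ⊛ f /x , (f ^ 2) /x))
    × (IsRiordan (f /x) X × B ≈ array ((f /x , X) · (g , (f ^ 2) /x)))
mainTheorem1 g f R =
    (riordan g g₀≡1 , λ n k → ⊛-^-even f f₀≡0 k g n)
  , (riordan (g ⊛ f /x) (⊛-const-one g (f /x) g₀≡1 f₁≡1) , odd)
  , ( record { g₀≡1 = f₁≡1 ; f₀≡0 = refl ; f₁≡1 = refl }
    , λ n k → trans (odd n k) (⊛-cong commuted (^-cong (λ m → sym (∘-identityʳ F m)) k) n))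
  where
  open IsRiordan R
  F : FPS
  F = (f ^ 2) /x

  -- This form exposes the low coefficients of `F`: the factor `f` kills the constant term, and
  -- dividing by x once more leaves the square of `f /x`, whose constant term is 1.
  f²/x≗ : F ≗ f /x ⊛ f
  f²/x≗ n = trans (/x-⊛ f (f ^ 1) f₀≡0 n)
    (⊛-cong {a = f /x} (λ _ → refl) (⊛-identityʳ f) n)

  F₁≡1 : F 1 ≡ 1ℤ
  F₁≡1 = trans (f²/x≗ 1) (trans (⊛-/x (f /x) f f₀≡0 0)
    (⊛-const-one (f /x) (f /x) f₁≡1 f₁≡1))

  riordan : ∀ h → h 0 ≡ 1ℤ → IsRiordan h F
  riordan h h₀≡1 = record
    { g₀≡1 = h₀≡1
    ; f₀≡0 = trans (f²/x≗ 0) (⊛-const-zeroʳ (f /x) f f₀≡0)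
    ; f₁≡1 = F₁≡1
    }

  odd : oddColumns (array (g , f)) ≈ array (g ⊛ f /x , F)
  odd n k = ⊛-^-odd f f₀≡0 k g n

  -- The right side is the first component of the product `(f /x , X) · (g , F)`; composing with `X`
  -- changes nothing, so only the order of the factors differs.
  commuted : g ⊛ f /x ≗ f /x ⊛ (g ∘ X)
  commuted n = trans (⊛-comm g (f /x) n)
    (⊛-cong {a = f /x} (λ _ → refl) (λ m → sym (∘-identityʳ g m)) n)
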